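{- Let $c\in(0,1]$ be a constant and let $\sigma,N\ge2$ be integers. Call an integer $m\ge2$ admissible if, for $\ell:=\lfloor c\log_\sigma m\rfloor$, it holds $\ell\ge1$ and $m\ell\le N$, and assume that an admissible $m$ exists. Any data structure supporting prefix special rank queries for every admissible $m$ and every sequence $W[1..m]$ of $m$ strings over alphabet $[0..\sigma)$, each of length exactly $\ell=\lfloor c\log_\sigma m\rfloor$, has worst-case space usage $\Omega(N\log\sigma)$ bits (with the hidden constant depending on at most $c$).
   Context: Here $[0..\sigma)=\{0,\dots,\sigma-1\}$ and $\log$ without a base is base 2. For a sequence $W[1..m]$ of strings of length $\ell$, $i\in\{1,\dots,m\}$ and $p\in\{0,\dots,\ell\}$, the prefix special rank query returns $\mathsf{prefix\text{ - }special\text{ - }rank}_W(i,p)=|\{j\in\{1,\dots,i\}:W[i][1..p]\text{ is a prefix of }W[j]\}|$. A data structure supporting a query problem for a family of inputs (with parameters $c,\sigma,N$ fixed) assigns to each input a finite bit string; the answer to every query on an input is determined by the stored bit string and the query arguments only. The space used on an input is the length of its bit string, and the worst-case space usage is the maximum over all inputs in the family. Query time is irrelevant. -}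

module Defs where

open import Data.Bool.Base using (Bool)
open import Data.Fin.Base as Fin using (Fin; toℕ)
import Data.Fin.Properties as Fin
open import Data.Integer.Base as ℤ using (∣_∣)
open import Data.List.Base as List using (List)
open import Data.List.Relation.Binary.Prefix.Heterogeneous.Properties using (prefix?)
open import Data.Nat.Base as ℕ using (ℕ; suc)
open import Data.Product.Base using (_×_; ∃-syntax)
open import Data.Rational.Base as ℚ using (ℚ; 0ℚ; ↥_; ↧ₙ_)
open import Data.Sum.Base using (_⊎_)
open import Data.Vec.Base using (Vec; lookup; toList; allFin; count)
open import Relation.Binary.PropositionalEquality using (_≡_)
open import Relation.Nullary using (¬_)
open import Relation.Nullary.Decidable using (_×-dec_)

infixl 7 _*ᴿ_
infix  4 _≤ᴿ_ _<ᴿ_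

-- Real numbers as Dedekind cuts of ℚ.  `Cut` is the raw pair of predicates;
-- `IsReal` holds the laws that make it a real number.

record Cut : Set₁ where
  field
    lower : ℚ → Set   -- lower q : q is less than the number
    upper : ℚ → Set   -- upper q : q is greater than the number

open Cut public

record IsReal (x : Cut) : Set where
  field
    lower-inhabited : ∃[ q ] lower x q
    upper-inhabited : ∃[ q ] upper x q
    lower-closed    : ∀ {q r} → q ℚ.< r → lower x r → lower x q
    upper-closed    : ∀ {q r} → q ℚ.< r → upper x q → upper x r
    lower-open      : ∀ {q} → lower x q → ∃[ r ] (q ℚ.< r × lower x r)
    upper-open      : ∀ {r} → upper x r → ∃[ q ] (q ℚ.< r × upper x q)
    disjoint        : ∀ {q} → ¬ (lower x q × upper x q)
    located         : ∀ {q r} → q ℚ.< r → lower x q ⊎ upper x r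

_≤ᴿ_ : Cut → Cut → Set
x ≤ᴿ y = ∀ q → lower x q → lower y q

_<ᴿ_ : Cut → Cut → Set
x <ᴿ y = ∃[ q ] (upper x q × lower y q)

fromℚ : ℚ → Cut
fromℚ p .lower q = q ℚ.< p
fromℚ p .upper q = p ℚ.< q

fromℕ : ℕ → Cut
fromℕ n = fromℚ (ℤ.+ n ℚ./ 1)

-- Multiplication of positive reals (the only products used here).
_*ᴿ_ : Cut → Cut → Cut
(x *ᴿ y) .lower q =
  ∃[ r ] ∃[ s ] (0ℚ ℚ.< r × 0ℚ ℚ.< s × lower x r × lower y s × q ℚ.< r ℚ.* s)
(x *ᴿ y) .upper q =
  ∃[ r ] ∃[ s ] (upper x r × upper y s × r ℚ.* s ℚ.< q)

-- The logarithm of n to base b, for b ≥ 2 and n ≥ 1 (so that it is ≥ 0): for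
-- q = u / v ≥ 0, q < log b n iff b ^ (u / v) < n iff b ^ u < n ^ v.
log : ℕ → ℕ → Cut
log b n .lower q = q ℚ.< 0ℚ ⊎ b ℕ.^ ∣ ↥ q ∣ ℕ.< n ℕ.^ ↧ₙ q
log b n .upper q = 0ℚ ℚ.≤ q × n ℕ.^ ↧ₙ q ℕ.< b ℕ.^ ∣ ↥ q ∣

-- k = ⌊ x ⌋, for x ≥ 0.  A relation, since the floor of a real number is not
-- computable.
IsFloor : Cut → ℕ → Set
IsFloor x k = fromℕ k ≤ᴿ x × x <ᴿ fromℕ (suc k)

-- m is admissible, with ℓ = ⌊ c log_σ m ⌋.
Admissible : Cut → ℕ → ℕ → ℕ → ℕ → Set
Admissible c σ N m ℓ =
  2 ℕ.≤ m × IsFloor (c *ᴿ log σ m) ℓ × 1 ℕ.≤ ℓ × m ℕ.* ℓ ℕ.≤ N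

-- Positions i are 0-based here: `i` stands for index toℕ i + 1.
prefixSpecialRank : ∀ {σ ℓ m} → Vec (Vec (Fin σ) ℓ) m → Fin m → Fin (suc ℓ) → ℕ
prefixSpecialRank W i p =
  count (λ j → (j Fin.≤? i) ×-dec
               prefix? Fin._≟_ (List.take (toℕ p) (toList (lookup W i)))
                               (toList (lookup W j)))
        (allFin _)

-- Admissibility is irrelevant, so an encoding can depend only on m and W
-- (ℓ being determined by m).
record Input (c : Cut) (σ N : ℕ) : Set where
  constructor input
  field
    {m ℓ}       : ℕ
    .admissible : Admissible c σ N m ℓ
    W           : Vec (Vec (Fin σ) ℓ) m

-- `answer` sees only the stored bits and the query arguments, with i ∈ {1,…,m}
-- and p ∈ {0,…,ℓ}.
record DataStructure (c : Cut) (σ N : ℕ) : Set where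
  field
    encode  : Input c σ N → List Bool
    answer  : List Bool → ℕ → ℕ → ℕ
    correct : ∀ (I : Input c σ N) (i : Fin (Input.m I)) (p : Fin (suc (Input.ℓ I))) →
              answer (encode I) (suc (toℕ i)) (toℕ p) ≡
              prefixSpecialRank (Input.W I) i p

  space : Input c σ N → ℕ
  space I = List.length (encode I)

-- S is the maximum of the space over all inputs.
IsWorstCaseSpace : ∀ {c σ N} → DataStructure c σ N → ℕ → Set
IsWorstCaseSpace D S = (∀ I → space I ℕ.≤ S) × (∃[ I ] space I ≡ S)
  where open DataStructure D

{-# OPTIONS --safe #-}

-- Let k = σ ^ ℓ and let d be about √(min m k), so that log d = Ω(ℓ log σ).  Among the words over d letters
-- consider those that start by giving the letters the pairwise distinct multiplicities d − 1, …, 1, 0, which takes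
-- at most m / 2 positions, and continue with permutations of the letters.  Inside a permutation the
-- unused letters always have distinct multiplicities, so the rank at a position reveals the letter there, and the
-- answers for p = ℓ determine the word.  There are about (d !) ^ (m / 2d) such words, whence S = Ω(m ℓ log σ).
--
-- Passing from m to m + 1 at most doubles log m, hence ℓ becomes at most 2 ℓ + 1; so some admissible m
-- has N ≤ 5 m ℓ.  The floor that defines ℓ exists only classically, which is enough: the bound that is derived
-- from it is decidable.

module Submission where

open import Defs
open import Data.Bool.Base using (Bool; true; false; if_then_else_; _∧_)
open import Data.Fin.Base as Fin using (Fin; zero; suc; toℕ; punchIn; punchOut; remQuot; finToFun; funToFin; fromℕ<; combine; inject≤)
import Data.Fin.Properties as Fin
open import Data.Integer.Base as ℤ using (∣_∣; -[1+_]) renaming (+_ to pos)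
import Data.Integer.Properties as ℤ
open import Data.List.Base as List using (List; []; _∷_)
import Data.List.Properties as List
open import Data.List.Relation.Binary.Pointwise using (Pointwise-≡⇒≡; ≡⇒Pointwise-≡)
open import Data.List.Relation.Binary.Prefix.Heterogeneous.Properties using (prefix?; fromPointwise; toPointwise)
open import Data.Nat.Base
open import Data.Nat.Properties
open import Data.Nat.Tactic.RingSolver using (solve-∀)
open import Data.Product.Base using (_×_; _,_; ∃-syntax; uncurry)
open import Data.Rational.Base as ℚ using (ℚ; mkℚ; 0ℚ; 1ℚ; ↥_; ↧ₙ_; toℚᵘ; fromℚᵘ)
import Data.Rational.Properties as ℚ
open import Data.Rational.Unnormalised.Base as ℚᵘ using (mkℚᵘ; *≡*; *<*; *≤*)
import Data.Rational.Unnormalised.Properties as ℚᵘ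
open import Data.Sum.Base using (_⊎_; inj₁; inj₂)
open import Data.Vec.Base as Vec using (Vec; []; _∷_; lookup; toList; count; tabulate)
import Data.Vec.Properties as Vec
open import Function.Base using (_∘_; id; const)
open import Function.Bundles using (mk⇔)
open import Function.Definitions using (Injective)
open import Relation.Binary.PropositionalEquality
open import Relation.Nullary using (¬_; yes; no; does; contradiction)
open import Relation.Nullary.Decidable using (_×-dec_; dec-true; dec-false; does-⇔; decidable-stable; ¬¬-excluded-middle)
open import Relation.Nullary.Negation.Core using (¬¬-map)
open import Relation.Unary using (Decidable)

private
  variable
    d e n M σ ℓ m : ℕ

-- Words distinguished by their ranks

bump : (Fin d → ℕ) → Fin d → Fin d → ℕ
bump κ x y = if does (y Fin.≟ x) then suc (κ y) else κ y

bump-≡ : (κ : Fin d → ℕ) (x : Fin d) → bump κ x x ≡ suc (κ x)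
bump-≡ κ x rewrite dec-true (x Fin.≟ x) refl = refl

bump-≢ : (κ : Fin d → ℕ) {x y : Fin d} → y ≢ x → bump κ x y ≡ κ y
bump-≢ κ {x} {y} y≢x rewrite dec-false (y Fin.≟ x) y≢x = refl

-- κ y is the number of earlier occurrences of y, so these ranks are one less than the special ranks.
ranks : (Fin d → ℕ) → Vec (Fin d) n → Vec ℕ n
ranks κ []      = []
ranks κ (x ∷ w) = κ x ∷ ranks (bump κ x) w

-- Words are built from the front, so κ is a parameter: it holds the occurrences in the part that is
-- already fixed.
record Distinguishes (κ : Fin d → ℕ) (n M : ℕ) : Set where
  constructor distinguishing
  field
    word           : Fin M → Vec (Fin d) n
    word-injective : Injective _≡_ _≡_ (ranks κ ∘ word)

open Distinguishes

empty : {κ : Fin d → ℕ} → Distinguishes κ 0 1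
empty .word           _ = []
empty .word-injective {zero} {zero} _ = refl

forced : {κ : Fin d → ℕ} (x : Fin d) → Distinguishes (bump κ x) n M → Distinguishes κ (suc n) M
forced x D .word           i  = x ∷ word D i
forced x D .word-injective eq = word-injective D (Vec.∷-injectiveʳ eq)

-- The candidate letters have distinct counts, so the first rank reveals which of them was written,
-- and the e families of M words are told apart.
branch : {κ : Fin d → ℕ} (ι : Fin e → Fin d) → Injective _≡_ _≡_ (κ ∘ ι) →
         (∀ i → Distinguishes (bump κ (ι i)) n M) → Distinguishes κ (suc n) (e * M)
branch {d} {e} {n} {M} {κ} ι ι-inj D = distinguishing (letters ∘ remQuot M) inj
  where
  letters : Fin e × Fin M → Vec (Fin d) (suc n)
  letters (i , j) = ι i ∷ word (D i) j

  letters-inj : Injective _≡_ _≡_ (ranks κ ∘ letters)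
  letters-inj {i , _} eq with refl ← ι-inj (Vec.∷-injectiveˡ eq) =
    cong (i ,_) (word-injective (D i) (Vec.∷-injectiveʳ eq))

  inj : Injective _≡_ _≡_ (ranks κ ∘ letters ∘ remQuot M)
  inj {p} {q} eq = begin
    p                                 ≡⟨ Fin.combine-remQuot {e} M p ⟨
    uncurry combine (remQuot {e} M p) ≡⟨ cong (uncurry combine) (letters-inj eq) ⟩
    uncurry combine (remQuot {e} M q) ≡⟨ Fin.combine-remQuot {e} M q ⟩
    q                                 ∎
    where open ≡-Reasoning

-- A position inside a permutation of the letters, e of which are still unused.
record Block (κ : Fin d → ℕ) (e : ℕ) : Set where
  field
    start            : Fin d → ℕ
    start-injective  : Injective _≡_ _≡_ start
    unused           : Fin e → Fin d
    unused-injective : Injective _≡_ _≡_ unused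
    unused-count     : ∀ j → κ (unused j) ≡ start (unused j)
    used-count       : ∀ y → (∃[ j ] unused j ≡ y) ⊎ κ y ≡ suc (start y)

  count-injective : Injective _≡_ _≡_ (κ ∘ unused)
  count-injective {i} {j} eq = unused-injective (start-injective
    (trans (sym (unused-count i)) (trans eq (unused-count j))))

newBlock : {κ : Fin d → ℕ} → Injective _≡_ _≡_ κ → Block κ d
newBlock {κ = κ} inj = record
  { start            = κ
  ; start-injective  = inj
  ; unused           = id
  ; unused-injective = id
  ; unused-count     = λ _ → refl
  ; used-count       = λ y → inj₁ (y , refl)
  }

-- Over a whole permutation every count grows by exactly one, so the counts are distinct again and
-- the next permutation can start.
finished-injective : {κ : Fin d → ℕ} → Block κ 0 → Injective _≡_ _≡_ κ
finished-injective {κ = κ} B {x} {y} eq =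
  start-injective (suc-injective (trans (sym (full x)) (trans eq (full y))))
  where
  open Block B
  full : ∀ y → κ y ≡ suc (start y)
  full y with used-count y
  ... | inj₂ eq = eq

use : {κ : Fin d → ℕ} (B : Block κ (suc e)) (i : Fin (suc e)) → Block (bump κ (Block.unused B i)) e
use {κ = κ} B i = record
  { start            = start
  ; start-injective  = start-injective
  ; unused           = unused ∘ punchIn i
  ; unused-injective = λ eq → Fin.punchIn-injective i _ _ (unused-injective eq)
  ; unused-count     = λ j → trans
      (bump-≢ κ λ eq → Fin.punchInᵢ≢i i j (unused-injective eq))
      (unused-count (punchIn i j))
  ; used-count       = used′
  }
  where
  open Block B
  used′ : ∀ y → (∃[ j ] unused (punchIn i j) ≡ y) ⊎ bump κ (unused i) y ≡ suc (start y)
  used′ y with y Fin.≟ unused i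
  ... | yes refl = inj₂ (cong suc (unused-count i))
  ... | no y≢ with used-count y
  ...   | inj₂ eq         = inj₂ eq
  ...   | inj₁ (j , refl) = inj₁ (punchOut i≢j , cong unused (Fin.punchIn-punchOut i≢j))
    where
    i≢j : i ≢ j
    i≢j refl = y≢ refl

-- Number of words of length n when e of the 1 + d letters are unused in the current block.
choices : ℕ → ℕ → ℕ → ℕ
choices d e       zero    = 1
choices d zero    (suc n) = suc d * choices d d n
choices d (suc e) (suc n) = suc e * choices d e n

blocks : ∀ {d} e n {κ : Fin (suc d) → ℕ} → Block κ e → Distinguishes κ n (choices d e n)
blocks e       zero    B = empty
blocks {d} zero (suc n) {κ} B =
  branch id κ-inj λ i → blocks d n (use (newBlock κ-inj) i)
  where
  κ-inj : Injective _≡_ _≡_ κ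
  κ-inj = finished-injective B
blocks (suc e) (suc n) B =
  branch (Block.unused B) (Block.count-injective B) λ i → blocks e n (use B i)

-- The continuation knows the counts after the repetitions only by their values, which is all that
-- the later arguments use.
repeat : (x : Fin d) (t : ℕ) (κ : Fin d → ℕ) →
         (∀ κ′ → κ′ x ≡ t + κ x → (∀ y → y ≢ x → κ′ y ≡ κ y) → Distinguishes κ′ n M) →
         Distinguishes κ (t + n) M
repeat x zero    κ cont = cont κ refl (λ _ _ → refl)
repeat x (suc t) κ cont = forced x (repeat x t (bump κ x) λ κ′ eq neq →
  cont κ′ (trans eq (trans (cong (t +_) (bump-≡ κ x)) (+-suc t (κ x))))
          (λ y y≢x → trans (neq y y≢x) (bump-≢ κ y≢x)))

-- This is 0 + 1 + ... + (e - 1) + n, nested so that each `repeat` in `staircase` has the right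
-- length by computation.
staircaseLength : ℕ → ℕ → ℕ
staircaseLength zero    n = n
staircaseLength (suc e) n = e + staircaseLength e n

-- The first letter receives its occurrences, and the others recursively get distinct smaller
-- counts. The continuation carries the bound on the counts and the fact that letters outside ι are
-- untouched; together they keep the first letter apart.
staircase : ∀ e (ι : Fin e → Fin d) → Injective _≡_ _≡_ ι → (κ : Fin d → ℕ) →
            (∀ j → κ (ι j) ≡ 0) →
            (∀ κ′ → Injective _≡_ _≡_ (κ′ ∘ ι) → (∀ j → κ′ (ι j) < e) →
                    (∀ y → (∀ j → ι j ≢ y) → κ′ y ≡ κ y) → Distinguishes κ′ n M) →
            Distinguishes κ (staircaseLength e n) M
staircase zero    ι ι-inj κ κ≡0 cont = cont κ (λ { {()} }) (λ ()) (λ _ _ → refl)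
staircase (suc e) ι ι-inj κ κ≡0 cont =
  repeat (ι zero) e κ λ κ′ κ′x κ′y →
  staircase e (ι ∘ suc) (Fin.suc-injective ∘ ι-inj) κ′
    (λ j → trans (κ′y (ι (suc j)) (λ eq → contradiction (ι-inj eq) λ ())) (κ≡0 (suc j)))
    λ κ″ inj bound outside →
    let top : κ″ (ι zero) ≡ e
        top = trans (outside (ι zero) (λ j eq → contradiction (ι-inj eq) λ ()))
                    (trans κ′x (trans (cong (e +_) (κ≡0 zero)) (+-identityʳ e)))
    in cont κ″
      (λ { {zero}  {zero}  eq → refl
         ; {zero}  {suc j} eq → contradiction (trans (sym eq) top) (<⇒≢ (bound j))
         ; {suc i} {zero}  eq → contradiction (trans eq top) (<⇒≢ (bound i))
         ; {suc i} {suc j} eq → cong suc (inj eq) })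
      (λ { zero    → ≤-reflexive (cong suc top)
         ; (suc j) → m≤n⇒m≤1+n (bound j) })
      (λ y y∉ → trans (outside y (y∉ ∘ suc)) (κ′y y (λ { refl → y∉ zero refl })))

distinguishes : ∀ d n → Distinguishes {suc d} (const 0) (staircaseLength (suc d) n) (choices d (suc d) n)
distinguishes d n =
  staircase (suc d) id id (const 0) (λ _ → refl) λ κ inj _ _ → blocks (suc d) n (newBlock inj)

-- Special ranks of encoded words

tally : (Fin n → Bool) → ℕ
tally {zero}  b = 0
tally {suc n} b = if b zero then suc (tally (b ∘ suc)) else tally (b ∘ suc)

tally-cong : {b b′ : Fin n → Bool} → (∀ i → b i ≡ b′ i) → tally b ≡ tally b′
tally-cong {zero}  eq = refl
tally-cong {suc n} eq rewrite eq zero | tally-cong (eq ∘ suc) = refl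

tally-false : tally {n} (const false) ≡ 0
tally-false {zero}  = refl
tally-false {suc n} = tally-false {n}

count-tabulate : ∀ {A : Set} {P : A → Set} (P? : Decidable P) (f : Fin n → A) →
                 count P? (tabulate f) ≡ tally (does ∘ P? ∘ f)
count-tabulate {zero}  P? f = refl
count-tabulate {suc n} P? f rewrite count-tabulate P? (f ∘ suc) with does (P? (f zero))
... | true  = refl
... | false = refl

-- κ is arbitrary for the induction: dropping the head letter moves its contribution from the tally
-- into κ. The successor on the right counts position i itself.
tally-rank : (κ : Fin d → ℕ) (w : Vec (Fin d) n) (i : Fin n) →
             κ (lookup w i) + tally (λ j → does (j Fin.≤? i) ∧ does (lookup w i Fin.≟ lookup w j)) ≡
             suc (lookup (ranks κ w) i)
tally-rank {n = suc n} κ (x ∷ w) zero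
  rewrite dec-true (x Fin.≟ x) refl | tally-false {n} = +-comm (κ x) 1
tally-rank κ (x ∷ w) (suc i) = trans head-split (tally-rank (bump κ x) w i)
  where
  y = lookup w i
  tail = tally (λ j → does (j Fin.≤? i) ∧ does (y Fin.≟ lookup w j))

  tail-eq : tally (λ j → does (suc j Fin.≤? suc i) ∧ does (y Fin.≟ lookup w j)) ≡ tail
  tail-eq = tally-cong λ j → cong (_∧ does (y Fin.≟ lookup w j))
    (does-⇔ (mk⇔ s≤s⁻¹ s≤s) (suc j Fin.≤? suc i) (j Fin.≤? i))

  head-split : κ y + tally (λ j → does (j Fin.≤? suc i) ∧ does (y Fin.≟ lookup (x ∷ w) j)) ≡
               bump κ x y + tail
  head-split rewrite tail-eq with does (y Fin.≟ x)
  ... | true  = +-suc (κ y) tail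
  ... | false = refl

-- With p = ℓ nothing is cut off, and a prefix of full length is the whole string.
whole-prefix⇔≡ : (u v : Vec (Fin σ) ℓ) →
  does (prefix? Fin._≟_ (List.take (toℕ (Fin.fromℕ ℓ)) (toList u)) (toList v)) ≡ does (Vec.≡-dec Fin._≟_ u v)
whole-prefix⇔≡ {ℓ = ℓ} u v
  rewrite Fin.toℕ-fromℕ ℓ | List.take-all ℓ (toList u) (≤-reflexive (Vec.length-toList u)) =
  does-⇔ (mk⇔ (λ pre → trans (sym (Vec.cast-is-id refl u)) (Vec.toList-injective refl u v (Pointwise-≡⇒≡ (toPointwise same-length pre))))
              (λ { refl → fromPointwise (≡⇒Pointwise-≡ refl) }))
         (prefix? Fin._≟_ (toList u) (toList v)) (Vec.≡-dec Fin._≟_ u v)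
  where
  same-length : List.length (toList u) ≡ List.length (toList v)
  same-length = trans (Vec.length-toList u) (sym (Vec.length-toList v))

prefixSpecialRank-map : {ε : Fin d → Vec (Fin σ) ℓ} → Injective _≡_ _≡_ ε → (w : Vec (Fin d) m) (i : Fin m) →
  prefixSpecialRank (Vec.map ε w) i (Fin.fromℕ ℓ) ≡ suc (lookup (ranks (const 0) w) i)
prefixSpecialRank-map {ℓ = ℓ} {ε = ε} ε-inj w i = begin
  prefixSpecialRank W i (Fin.fromℕ ℓ)
    ≡⟨ count-tabulate (λ j → (j Fin.≤? i) ×-dec isPrefix? j) id ⟩
  tally (λ j → does (j Fin.≤? i) ∧ does (isPrefix? j))
    ≡⟨ tally-cong (λ j → cong (does (j Fin.≤? i) ∧_) (same j)) ⟩
  tally (λ j → does (j Fin.≤? i) ∧ does (lookup w i Fin.≟ lookup w j))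
    ≡⟨ tally-rank (const 0) w i ⟩
  suc (lookup (ranks (const 0) w) i) ∎
  where
  open ≡-Reasoning
  W = Vec.map ε w

  isPrefix? = λ j → prefix? Fin._≟_ (List.take (toℕ (Fin.fromℕ ℓ)) (toList (lookup W i))) (toList (lookup W j))

  same : ∀ j → does (isPrefix? j) ≡ does (lookup w i Fin.≟ lookup w j)
  same j = trans (whole-prefix⇔≡ (lookup W i) (lookup W j))
    (does-⇔ (mk⇔ (λ eq → ε-inj (trans (sym (Vec.lookup-map i ε w)) (trans eq (Vec.lookup-map j ε w))))
                 (λ eq → trans (Vec.lookup-map i ε w) (trans (cong ε eq) (sym (Vec.lookup-map j ε w)))))
            (Vec.≡-dec Fin._≟_ _ _) (lookup w i Fin.≟ lookup w j))

-- Bit strings and the number of distinct encodings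

bitsToℕ : List Bool → ℕ
bitsToℕ []          = 0
bitsToℕ (false ∷ b) = 1 + 2 * bitsToℕ b
bitsToℕ (true  ∷ b) = 2 + 2 * bitsToℕ b

-- `bitsToℕ` is bijective base 2 with digits 1 and 2, so strings of different lengths also get
-- different numbers; parity gives the first bit.
bitsToℕ-injective : Injective _≡_ _≡_ bitsToℕ
bitsToℕ-injective {[]} {[]} _ = refl
bitsToℕ-injective {[]} {false ∷ _} ()
bitsToℕ-injective {[]} {true ∷ _} ()
bitsToℕ-injective {false ∷ _} {[]} ()
bitsToℕ-injective {true ∷ _} {[]} ()
bitsToℕ-injective {false ∷ b} {false ∷ b′} eq =
  cong (false ∷_) (bitsToℕ-injective (*-cancelˡ-≡ _ _ 2 (suc-injective eq)))
bitsToℕ-injective {true ∷ b} {true ∷ b′} eq =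
  cong (true ∷_) (bitsToℕ-injective (*-cancelˡ-≡ _ _ 2 (suc-injective (suc-injective eq))))
bitsToℕ-injective {false ∷ b} {true ∷ b′} eq =
  contradiction (suc-injective eq) (even≢odd (bitsToℕ b) (bitsToℕ b′))
bitsToℕ-injective {true ∷ b} {false ∷ b′} eq =
  contradiction (sym (suc-injective eq)) (even≢odd (bitsToℕ b′) (bitsToℕ b))

-- The 2 on the left makes the induction exact for the larger digit: 2 + (2 + 2 x) = 2 (2 + x).
bitsToℕ-bound : ∀ b → 2 + bitsToℕ b ≤ 2 ^ suc (List.length b)
bitsToℕ-bound []      = ≤-refl
bitsToℕ-bound (x ∷ b) = ≤-trans (step x) (*-monoʳ-≤ 2 (bitsToℕ-bound b))
  where
  step : ∀ x → 2 + bitsToℕ (x ∷ b) ≤ 2 * (2 + bitsToℕ b)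
  step false = ≤-trans (n≤1+n _) (≤-reflexive (sym (*-distribˡ-+ 2 2 (bitsToℕ b))))
  step true  = ≤-reflexive (sym (*-distribˡ-+ 2 2 (bitsToℕ b)))

-- There are 2 ^ (S + 1) - 1 bit strings of length at most S, and `bitsToℕ` numbers them from 0.
injective⇒<2^ : ∀ {S} (f : Fin M → List Bool) → Injective _≡_ _≡_ f → (∀ i → List.length (f i) ≤ S) →
                M < 2 ^ suc S
injective⇒<2^ {M} {S} f f-inj len = ≤-trans (s≤s (Fin.injective⇒≤ g-inj)) (≤-reflexive (suc-pred (2 ^ suc S)))
  where
  instance _ = m^n≢0 2 (suc S)
  bound : ∀ i → bitsToℕ (f i) < pred (2 ^ suc S)
  bound i = pred-mono-≤ (≤-trans (bitsToℕ-bound (f i)) (^-monoʳ-≤ 2 (s≤s (len i))))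
  g : Fin M → Fin (pred (2 ^ suc S))
  g i = fromℕ< (bound i)
  g-inj : Injective _≡_ _≡_ g
  g-inj eq = f-inj (bitsToℕ-injective (Fin.fromℕ<-injective _ _ (bound _) (bound _) eq))

finToFun-injective : ∀ a b {x y : Fin (a ^ b)} → (∀ k → finToFun {a} {b} x k ≡ finToFun y k) → x ≡ y
finToFun-injective a b {x} {y} eq = begin
  x                            ≡⟨ Fin.funToFin-finToFin {b} {a} x ⟨
  funToFin (finToFun {a} {b} x) ≡⟨ funToFin-cong eq ⟩
  funToFin (finToFun {a} {b} y) ≡⟨ Fin.funToFin-finToFin {b} {a} y ⟩
  y                            ∎
  where
  open ≡-Reasoning
  funToFin-cong : ∀ {b} {f g : Fin b → Fin a} → (∀ k → f k ≡ g k) → funToFin f ≡ funToFin g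
  funToFin-cong {zero}  eq = refl
  funToFin-cong {suc b} eq = cong₂ combine (eq zero) (funToFin-cong (eq ∘ suc))

-- Equal encodings give equal answers for p = ℓ, hence equal ranks, hence the same word.
space-bound : ∀ {c N S} (D : DataStructure c σ N) → (∀ I → DataStructure.space D I ≤ S) →
              Admissible c σ N m ℓ → d ≤ σ ^ ℓ → Distinguishes {d} (const 0) m M → M < 2 ^ suc S
space-bound {σ} {m} {ℓ} {d} {M} {c} {N} D space≤S adm d≤σ^ℓ D′ =
  injective⇒<2^ (encode ∘ I) encode-inj (space≤S ∘ I)
  where
  open DataStructure D

  -- A letter becomes the string of its ℓ digits in base σ.
  ε : Fin d → Vec (Fin σ) ℓ
  ε x = tabulate (finToFun (inject≤ x d≤σ^ℓ))

  ε-inj : Injective _≡_ _≡_ ε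
  ε-inj {x} {y} eq = Fin.inject≤-injective _ _ x y (finToFun-injective σ ℓ λ k →
    trans (sym (Vec.lookup∘tabulate _ k)) (trans (cong (λ v → lookup v k) eq) (Vec.lookup∘tabulate _ k)))

  I : Fin M → Input c σ N
  I i = input adm (Vec.map ε (word D′ i))

  encode-inj : Injective _≡_ _≡_ (encode ∘ I)
  encode-inj {a} {b} eq = word-injective D′ (begin
    ranks (const 0) (word D′ a)                       ≡⟨ Vec.tabulate∘lookup _ ⟨
    tabulate (lookup (ranks (const 0) (word D′ a)))   ≡⟨ Vec.tabulate-cong same-rank ⟩
    tabulate (lookup (ranks (const 0) (word D′ b)))   ≡⟨ Vec.tabulate∘lookup _ ⟩
    ranks (const 0) (word D′ b)                       ∎)
    where
    open ≡-Reasoning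
    same-rank : ∀ i → lookup (ranks (const 0) (word D′ a)) i ≡ lookup (ranks (const 0) (word D′ b)) i
    same-rank i = suc-injective (begin
      suc (lookup (ranks (const 0) (word D′ a)) i)                       ≡⟨ prefixSpecialRank-map ε-inj (word D′ a) i ⟨
      prefixSpecialRank (Vec.map ε (word D′ a)) i (Fin.fromℕ ℓ)          ≡⟨ correct (I a) i (Fin.fromℕ ℓ) ⟨
      answer (encode (I a)) (suc (toℕ i)) (toℕ (Fin.fromℕ ℓ))         ≡⟨ cong (λ e → answer e (suc (toℕ i)) (toℕ (Fin.fromℕ ℓ))) eq ⟩
      answer (encode (I b)) (suc (toℕ i)) (toℕ (Fin.fromℕ ℓ))         ≡⟨ correct (I b) i (Fin.fromℕ ℓ) ⟩
      prefixSpecialRank (Vec.map ε (word D′ b)) i (Fin.fromℕ ℓ)          ≡⟨ prefixSpecialRank-map ε-inj (word D′ b) i ⟩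
      suc (lookup (ranks (const 0) (word D′ b)) i)                       ∎)

-- Counting the words

staircaseLength-+ : ∀ e n → staircaseLength e n ≡ staircaseLength e 0 + n
staircaseLength-+ zero    n = refl
staircaseLength-+ (suc e) n = trans (cong (e +_) (staircaseLength-+ e n)) (sym (+-assoc e _ n))

staircaseLength-suc : ∀ d → 2 * staircaseLength (suc d) 0 ≡ suc d * d
staircaseLength-suc zero    = refl
staircaseLength-suc (suc d) = begin-equality
  2 * (suc d + staircaseLength (suc d) 0)   ≡⟨ *-distribˡ-+ 2 (suc d) _ ⟩
  2 * suc d + 2 * staircaseLength (suc d) 0 ≡⟨ cong (2 * suc d +_) (staircaseLength-suc d) ⟩
  2 * suc d + suc d * d                     ≡⟨ lemma d ⟩
  suc (suc d) * suc d                       ∎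
  where
  open ≤-Reasoning
  lemma : ∀ d → 2 * suc d + suc d * d ≡ suc (suc d) * suc d
  lemma = solve-∀

-- From j to j + 1 the sides gain the factors d + 1 and d (j + 2) / (j + 1), and the former is at
-- most the latter when j + 1 ≤ d.
suc^≤suc* : ∀ {j d} → j ≤ d → suc d ^ j ≤ suc j * d ^ j
suc^≤suc* {zero}  {d} _   = ≤-refl
suc^≤suc* {suc j} {d} j<d = begin
  suc d * suc d ^ j             ≤⟨ *-monoʳ-≤ (suc d) (suc^≤suc* (<⇒≤ j<d)) ⟩
  suc d * (suc j * d ^ j)       ≡⟨ *-assoc (suc d) (suc j) (d ^ j) ⟨
  suc d * suc j * d ^ j         ≤⟨ *-monoˡ-≤ (d ^ j) step ⟩
  suc (suc j) * d * d ^ j       ≡⟨ *-assoc (suc (suc j)) d (d ^ j) ⟩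
  suc (suc j) * (d * d ^ j)     ∎
  where
  open ≤-Reasoning
  step : suc d * suc j ≤ suc (suc j) * d
  step = begin
    suc d * suc j       ≡⟨ *-suc (suc d) j ⟩
    suc d + suc d * j   ≡⟨ lhs d j ⟩
    suc j + d * suc j   ≤⟨ +-monoˡ-≤ (d * suc j) j<d ⟩
    d + d * suc j       ≡⟨ cong (d +_) (*-comm d (suc j)) ⟩
    suc (suc j) * d     ∎
    where
    lhs : ∀ d j → suc d + suc d * j ≡ suc j + d * suc j
    lhs = solve-∀

-- From d to d + 1 the right side gains the factor (d + 1)², and the left side at most that, by
-- `suc^≤suc*` for j = d.
^≤!² : ∀ d → d ^ d ≤ d ! * d !
^≤!² zero    = ≤-refl
^≤!² (suc d) = begin
  suc d * suc d ^ d             ≤⟨ *-monoʳ-≤ (suc d) (suc^≤suc* {d} ≤-refl) ⟩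
  suc d * (suc d * d ^ d)       ≤⟨ *-monoʳ-≤ (suc d) (*-monoʳ-≤ (suc d) (^≤!² d)) ⟩
  suc d * (suc d * (d ! * d !)) ≡⟨ regroup (suc d) (d !) ⟩
  suc d ! * suc d !             ∎
  where
  open ≤-Reasoning
  regroup : ∀ x y → x * (x * (y * y)) ≡ x * y * (x * y)
  regroup = solve-∀

-- Each of the e factors k² of the squared factorial is at most e² ≤ D.
!²≤^ : ∀ {D} e → e * e ≤ D → e ! * e ! ≤ D ^ e
!²≤^     zero    _    = ≤-refl
!²≤^ {D} (suc e) e²≤D = begin
  suc e * e ! * (suc e * e !)   ≡⟨ regroup (suc e) (e !) ⟩
  suc e * suc e * (e ! * e !)   ≤⟨ *-mono-≤ e²≤D (!²≤^ e (≤-trans (*-mono-≤ (n≤1+n e) (n≤1+n e)) e²≤D)) ⟩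
  D * D ^ e                     ∎
  where
  open ≤-Reasoning
  regroup : ∀ x y → x * y * (x * y) ≡ x * x * (y * y)
  regroup = solve-∀

-- The product of the choices is at least √D per step, where D = 1 + d: while e ≥ √D each step gains at least that
-- much, and below √D the loss is measured by e!² / Dᵉ, which (d+1)^(d+1) ≤ (d+1)!² makes up over a whole block.
Growth : ℕ → ℕ → ℕ → Set
Growth d e n = suc d ^ n ≤ F * F ⊎ suc d ^ n * (e ! * e !) ≤ F * F * suc d ^ e
  where F = choices d e n

growth-suc : ∀ d e n → Growth d e n → Growth d (suc e) (suc n)
growth-suc d e n (inj₂ ≤F²) = inj₂ (begin
  D * D ^ n * (suc e * e ! * (suc e * e !)) ≡⟨ lhs D (D ^ n) (suc e) (e !) ⟩
  D ^ n * (e ! * e !) * (D * (suc e * suc e)) ≤⟨ *-monoˡ-≤ (D * (suc e * suc e)) ≤F² ⟩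
  F * F * D ^ e * (D * (suc e * suc e))     ≡⟨ rhs F (D ^ e) D (suc e) ⟩
  suc e * F * (suc e * F) * (D * D ^ e)     ∎)
  where
  open ≤-Reasoning
  D = suc d
  F = choices d e n
  lhs : ∀ a b c f → a * b * (c * f * (c * f)) ≡ b * (f * f) * (a * (c * c))
  lhs = solve-∀
  rhs : ∀ a b c f → a * a * b * (c * (f * f)) ≡ f * a * (f * a) * (c * b)
  rhs = solve-∀
growth-suc d e n (inj₁ ≤F²) with ≤-total (suc d) (suc e * suc e)
... | inj₁ D≤e² = inj₁ (begin
  suc d * suc d ^ n         ≤⟨ *-mono-≤ D≤e² ≤F² ⟩
  suc e * suc e * (F * F)   ≡⟨ regroup (suc e) F ⟩
  suc e * F * (suc e * F)   ∎)
  where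
  open ≤-Reasoning
  F = choices d e n
  regroup : ∀ x y → x * x * (y * y) ≡ x * y * (x * y)
  regroup = solve-∀
-- Once (e + 1)² ≤ D, a step may gain too little; the first alternative then implies the second,
-- since `e !` squared is at most D ^ e.
... | inj₂ e²≤D = growth-suc d e n (inj₂ (*-mono-≤ ≤F² (!²≤^ e (≤-trans (*-mono-≤ (n≤1+n e) (n≤1+n e)) e²≤D))))

^≤choices² : ∀ d n → suc d ^ n ≤ choices d (suc d) n * choices d (suc d) n
growth : ∀ d e n → Growth d e n

^≤choices² d n with growth d (suc d) n
... | inj₁ ≤F² = ≤F²
... | inj₂ ≤F² = *-cancelʳ-≤ _ _ (suc d ^ suc d) (≤-trans (*-monoʳ-≤ (suc d ^ n) (^≤!² (suc d))) ≤F²)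
  where instance _ = m^n≢0 (suc d) (suc d)

growth d e       zero    = inj₁ ≤-refl
growth d (suc e) (suc n) = growth-suc d e n (growth d e n)
growth d zero    (suc n) with growth-suc d d n (growth d d n)
... | inj₁ ≤F² = inj₁ ≤F²
... | inj₂ ≤F² = inj₁ (*-cancelʳ-≤ _ _ (suc d ^ suc d) (≤-trans (*-monoʳ-≤ (suc d ^ suc n) (^≤!² (suc d))) ≤F²))
  where instance _ = m^n≢0 (suc d) (suc d)

-- The space bound from one admissible length

pronic-root : ∀ T → 2 ≤ T → ∃[ d ] (1 ≤ d × suc d * d ≤ T × T < suc (suc d) * suc d)
pronic-root (suc zero)          (s≤s ())
pronic-root (suc (suc zero))    _ = 1 , ≤-refl , ≤-refl , s≤s (s≤s (s≤s z≤n))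
pronic-root (suc T@(suc (suc _))) _ with pronic-root T (s≤s (s≤s z≤n))
... | d , 1≤d , lower , upper with suc T <? suc (suc d) * suc d
...   | yes <next = d , 1≤d , m≤n⇒m≤1+n lower , <next
...   | no  ≮next = suc d , s≤s z≤n , ≮⇒≥ ≮next , ≤-<-trans upper
        (*-mono-< (n<1+n (suc (suc d))) (n<1+n (suc d)))

-- The constant is 240 = 5 · 6 · 8, from N ≤ 5 m ℓ, σ ^ ℓ ≤ B ^ 6 and B ^ m ≤ 2 ^ (8 S), where B = d
-- + 1 is the number of letters.
space-lower-bound : ∀ {c N S} (D : DataStructure c σ N) → (∀ I → DataStructure.space D I ≤ S) →
                    Admissible c σ N m ℓ → 2 ≤ σ → σ ^ ℓ < m ^ 2 → N ≤ 5 * (m * ℓ) →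
                    σ ^ N ≤ 2 ^ (240 * S)
space-lower-bound {σ} {m} {ℓ} {N = N} {S} D space≤S adm@(2≤m , _ , 1≤ℓ , _) 2≤σ σ^ℓ<m² N≤5mℓ
  -- d (d + 1) is exactly twice the staircase length for d + 1 letters, so it is compared with m;
  -- the comparison with σ ^ ℓ provides enough strings for the letters.
  with pronic-root (m ⊓ σ ^ ℓ) (⊓-glb 2≤m (≤-trans 2≤σ (≤-trans (≤-reflexive (sym (^-identityʳ σ))) (^-monoʳ-≤ σ 1≤ℓ))))
  where instance _ = >-nonZero (≤-trans (s≤s z≤n) 2≤σ)
... | d , 1≤d , lower , upper = begin
  σ ^ N                        ≤⟨ ^-monoʳ-≤ σ N≤5mℓ ⟩
  σ ^ (5 * (m * ℓ))            ≡⟨ cong (σ ^_) (exponent m ℓ) ⟩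
  σ ^ (ℓ * (5 * m))            ≡⟨ ^-*-assoc σ ℓ (5 * m) ⟨
  (σ ^ ℓ) ^ (5 * m)            ≤⟨ ^-monoˡ-≤ (5 * m) σ^ℓ≤B⁶ ⟩
  (B ^ 6) ^ (5 * m)            ≡⟨ ^-*-assoc B 6 (5 * m) ⟩
  B ^ (6 * (5 * m))            ≡⟨ cong (B ^_) (exponent′ m) ⟩
  B ^ (m * 30)                 ≡⟨ ^-*-assoc B m 30 ⟨
  (B ^ m) ^ 30                 ≤⟨ ^-monoˡ-≤ 30 B^m≤ ⟩
  (2 ^ (8 * S)) ^ 30           ≡⟨ ^-*-assoc 2 (8 * S) 30 ⟩
  2 ^ (8 * S * 30)             ≡⟨ cong (2 ^_) (exponent″ S) ⟩
  2 ^ (240 * S)                ∎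
  where
  open ≤-Reasoning
  instance
    _ = >-nonZero (≤-trans (s≤s z≤n) 2≤σ)
    d≢0 = >-nonZero 1≤d
  B = suc d
  T = m ⊓ σ ^ ℓ
  s = staircaseLength B 0
  r = m ∸ s
  F = choices d B r

  exponent : ∀ m ℓ → 5 * (m * ℓ) ≡ ℓ * (5 * m)
  exponent = solve-∀
  exponent′ : ∀ m → 6 * (5 * m) ≡ m * 30
  exponent′ = solve-∀
  exponent″ : ∀ S → 8 * S * 30 ≡ 240 * S
  exponent″ = solve-∀

  2s≤m : 2 * s ≤ m
  2s≤m = ≤-trans (≤-reflexive (staircaseLength-suc d)) (≤-trans lower (m⊓n≤m m _))

  m≡s+r : m ≡ s + r
  m≡s+r = sym (m+[n∸m]≡n (≤-trans (m≤n*m s 2) 2s≤m))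

  m≤2r : m ≤ r * 2
  m≤2r = +-cancelˡ-≤ m m (r * 2) (begin
    m + m         ≡⟨ cong₂ _+_ m≡s+r m≡s+r ⟩
    s + r + (s + r) ≡⟨ regroup s r ⟩
    2 * s + r * 2 ≤⟨ +-monoˡ-≤ (r * 2) 2s≤m ⟩
    m + r * 2     ∎)
    where
    regroup : ∀ s r → s + r + (s + r) ≡ 2 * s + r * 2
    regroup = solve-∀

  B≤σ^ℓ : B ≤ σ ^ ℓ
  B≤σ^ℓ = ≤-trans (m≤m*n B d) (≤-trans lower (m⊓n≤n m _))

  F<2^1+S : F < 2 ^ suc S
  F<2^1+S = space-bound D space≤S adm B≤σ^ℓ
    (subst (λ k → Distinguishes (const 0) k F) (trans (staircaseLength-+ B r) (sym m≡s+r)) (distinguishes d r))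

  1≤r : 1 ≤ r
  1≤r with r | m≤2r
  ... | zero  | m≤0 = contradiction (≤-trans 2≤m m≤0) λ ()
  ... | suc _ | _   = s≤s z≤n

  -- This rules out S = 0, so that the exponent 4 + 4 S below is at most 8 S.
  2≤F : 2 ≤ F
  2≤F = ≰⇒> λ F≤1 → <⇒≱ (s≤s (s≤s z≤n)) (begin
    2         ≤⟨ s≤s 1≤d ⟩
    B         ≡⟨ ^-identityʳ B ⟨
    B ^ 1     ≤⟨ ^-monoʳ-≤ B 1≤r ⟩
    B ^ r     ≤⟨ ^≤choices² d r ⟩
    F * F     ≤⟨ *-mono-≤ F≤1 F≤1 ⟩
    1         ∎)

  1≤S : ∀ {S} → F < 2 ^ suc S → 1 ≤ S
  1≤S {zero}  F<2 = contradiction (≤-trans (s≤s 2≤F) F<2) λ { (s≤s (s≤s ())) }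
  1≤S {suc _} _   = s≤s z≤n

  B^m≤ : B ^ m ≤ 2 ^ (8 * S)
  B^m≤ = begin
    B ^ m                       ≤⟨ ^-monoʳ-≤ B m≤2r ⟩
    B ^ (r * 2)                 ≡⟨ ^-*-assoc B r 2 ⟨
    (B ^ r) ^ 2                 ≤⟨ ^-monoˡ-≤ 2 (^≤choices² d r) ⟩
    (F * F) ^ 2                 ≤⟨ ^-monoˡ-≤ 2 (*-mono-≤ (<⇒≤ F<2^1+S) (<⇒≤ F<2^1+S)) ⟩
    (2 ^ suc S * 2 ^ suc S) ^ 2 ≡⟨ cong (_^ 2) (^-distribˡ-+-* 2 (suc S) (suc S)) ⟨
    (2 ^ (suc S + suc S)) ^ 2   ≡⟨ ^-*-assoc 2 (suc S + suc S) 2 ⟩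
    2 ^ ((suc S + suc S) * 2)   ≡⟨ cong (2 ^_) (double S) ⟩
    2 ^ (4 + 4 * S)             ≤⟨ ^-monoʳ-≤ 2 (+-monoˡ-≤ (4 * S) (*-monoʳ-≤ 4 (1≤S {S} F<2^1+S))) ⟩
    2 ^ (4 * S + 4 * S)         ≡⟨ cong (2 ^_) (*-distribʳ-+ S 4 4) ⟨
    2 ^ (8 * S)                 ∎
    where
    double : ∀ S → (suc S + suc S) * 2 ≡ 4 + 4 * S
    double = solve-∀

  T≤B³ : T ≤ B ^ 3
  T≤B³ = begin
    T             ≤⟨ <⇒≤ upper ⟩
    suc B * B     ≤⟨ *-monoˡ-≤ B (+-monoˡ-≤ B (≤-trans 1≤d (m≤m*n d B))) ⟩
    (d * B + B) * B ≡⟨ cube d ⟩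
    B ^ 3         ∎
    where
    cube : ∀ d → (d * suc d + suc d) * suc d ≡ suc d * (suc d * (suc d * 1))
    cube = solve-∀

  σ^ℓ≤T² : σ ^ ℓ ≤ T ^ 2
  σ^ℓ≤T² with ⊓-sel m (σ ^ ℓ)
  ... | inj₁ T≡m  = subst (λ t → σ ^ ℓ ≤ t ^ 2) (sym T≡m) (<⇒≤ σ^ℓ<m²)
  ... | inj₂ T≡σ^ℓ = subst (λ t → σ ^ ℓ ≤ t ^ 2) (sym T≡σ^ℓ) (m≤m*n (σ ^ ℓ) ((σ ^ ℓ) ^ 1))
    where
    instance
      _ = m^n≢0 σ ℓ
      _ = m^n≢0 (σ ^ ℓ) 1

  σ^ℓ≤B⁶ : σ ^ ℓ ≤ B ^ 6
  σ^ℓ≤B⁶ = begin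
    σ ^ ℓ       ≤⟨ σ^ℓ≤T² ⟩
    T ^ 2       ≤⟨ ^-monoˡ-≤ 2 T≤B³ ⟩
    (B ^ 3) ^ 2 ≡⟨ ^-*-assoc B 3 2 ⟩
    B ^ 6       ∎

-- Fractions and logarithms

-- frac w v = w / (1 + v)
frac : ℕ → ℕ → ℚ
frac w v = fromℚᵘ (mkℚᵘ (pos w) v)

frac-mono-< : ∀ {a b c d} → a * suc d < c * suc b → frac a b ℚ.< frac c d
frac-mono-< {a} {b} {c} {d} lt = ℚ.toℚᵘ-cancel-<
  (ℚᵘ.<-respʳ-≃ (ℚᵘ.≃-sym (ℚ.toℚᵘ-fromℚᵘ (mkℚᵘ (pos c) d)))
  (ℚᵘ.<-respˡ-≃ (ℚᵘ.≃-sym (ℚ.toℚᵘ-fromℚᵘ (mkℚᵘ (pos a) b)))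
  (*<* (subst₂ ℤ._<_ (ℤ.pos-* a (suc d)) (ℤ.pos-* c (suc b)) (ℤ.+<+ lt)))))

frac-mono-≤ : ∀ {a b c d} → a * suc d ≤ c * suc b → frac a b ℚ.≤ frac c d
frac-mono-≤ {a} {b} {c} {d} le = ℚ.toℚᵘ-cancel-≤
  (ℚᵘ.≤-respʳ-≃ (ℚᵘ.≃-sym (ℚ.toℚᵘ-fromℚᵘ (mkℚᵘ (pos c) d)))
  (ℚᵘ.≤-respˡ-≃ (ℚᵘ.≃-sym (ℚ.toℚᵘ-fromℚᵘ (mkℚᵘ (pos a) b)))
  (*≤* (subst₂ ℤ._≤_ (ℤ.pos-* a (suc d)) (ℤ.pos-* c (suc b)) (ℤ.+≤+ le)))))

frac-cancel-< : ∀ {a b c d} → frac a b ℚ.< frac c d → a * suc d < c * suc b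
frac-cancel-< {a} {b} {c} {d} lt = ≰⇒> λ ge → ℚ.<-irrefl refl (ℚ.<-≤-trans lt (frac-mono-≤ {c} {d} {a} {b} ge))

frac-* : ∀ a b c d → frac a b ℚ.* frac c d ≡ frac (a * c) (d + b * suc d)
frac-* a b c d = ℚ.toℚᵘ-injective (begin
  toℚᵘ (frac a b ℚ.* frac c d)              ≈⟨ ℚ.toℚᵘ-homo-* (frac a b) (frac c d) ⟩
  toℚᵘ (frac a b) ℚᵘ.* toℚᵘ (frac c d)      ≈⟨ ℚᵘ.*-cong (ℚ.toℚᵘ-fromℚᵘ (mkℚᵘ (pos a) b)) (ℚ.toℚᵘ-fromℚᵘ (mkℚᵘ (pos c) d)) ⟩
  mkℚᵘ (pos a) b ℚᵘ.* mkℚᵘ (pos c) d            ≡⟨ cong (λ k → mkℚᵘ k (d + b * suc d)) (ℤ.pos-* a c) ⟨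
  mkℚᵘ (pos (a * c)) (d + b * suc d)          ≈⟨ ℚ.toℚᵘ-fromℚᵘ (mkℚᵘ (pos (a * c)) (d + b * suc d)) ⟨
  toℚᵘ (frac (a * c) (d + b * suc d))       ∎)
  where open import Relation.Binary.Reasoning.Setoid ℚᵘ.≃-setoid

frac-double : ∀ a b → frac a b ℚ.+ frac a b ≡ frac (2 * a) b
frac-double a b = begin
  frac a b ℚ.+ frac a b               ≡⟨ cong₂ ℚ._+_ (ℚ.*-identityˡ (frac a b)) (ℚ.*-identityˡ (frac a b)) ⟨
  1ℚ ℚ.* frac a b ℚ.+ 1ℚ ℚ.* frac a b ≡⟨ ℚ.*-distribʳ-+ (frac a b) 1ℚ 1ℚ ⟨
  frac 2 0 ℚ.* frac a b               ≡⟨ frac-* 2 0 a b ⟩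
  frac (2 * a) (b + 0)                ≡⟨ cong (frac (2 * a)) (+-identityʳ b) ⟩
  frac (2 * a) b                      ∎
  where open ≡-Reasoning

frac-nonNeg : ∀ a b → 0ℚ ℚ.≤ frac a b
frac-nonNeg a b = frac-mono-≤ {0} {0} {a} {b} z≤n

frac-pos : ∀ {a} b → 0 < a → 0ℚ ℚ.< frac a b
frac-pos {a} b 0<a = frac-mono-< {0} {0} {a} {b} (≤-trans 0<a (m≤m*n a 1))

nonNeg⇒frac : ∀ {p} → 0ℚ ℚ.≤ p → p ≡ frac ∣ ↥ p ∣ (pred (↧ₙ p))
nonNeg⇒frac {mkℚ (pos _)    _ _} _          = sym (ℚ.fromℚᵘ-toℚᵘ _)
nonNeg⇒frac {mkℚ -[1+ _ ] _ _} (ℚ.*≤* ())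

^-cancelˡ-< : ∀ v {x y} → x ^ v < y ^ v → x < y
^-cancelˡ-< v lt = ≰⇒> λ ge → <⇒≱ lt (^-monoˡ-≤ v ge)

^-swap : ∀ x a b → (x ^ a) ^ b ≡ (x ^ b) ^ a
^-swap x a b = trans (^-*-assoc x a b) (trans (cong (x ^_) (*-comm a b)) (sym (^-*-assoc x b a)))

-- `frac` reduces to lowest terms, so the numerator and denominator that `log` sees match w and 1 +
-- v only after cross-multiplication.
frac-cross : ∀ w v → ∣ ↥ frac w v ∣ * suc v ≡ w * ↧ₙ frac w v
frac-cross w v with frac w v | ℚ.toℚᵘ-fromℚᵘ (mkℚᵘ (pos w) v)
... | mkℚ k d _ | *≡* eq = begin
  ∣ k ∣ * suc v       ≡⟨ ℤ.abs-* k (pos (suc v)) ⟨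
  ∣ k ℤ.* pos (suc v) ∣   ≡⟨ cong ∣_∣ eq ⟩
  ∣ pos w ℤ.* pos (suc d) ∣ ≡⟨ ℤ.abs-* (pos w) (pos (suc d)) ⟩
  w * suc d           ∎
  where open ≡-Reasoning

frac-^ : ∀ b w v → (b ^ ∣ ↥ frac w v ∣) ^ suc v ≡ (b ^ w) ^ ↧ₙ frac w v
frac-^ b w v = trans (^-*-assoc b ∣ ↥ frac w v ∣ (suc v))
  (trans (cong (b ^_) (frac-cross w v)) (sym (^-*-assoc b w (↧ₙ frac w v))))

log-lower : ∀ b n w v → b ^ w < n ^ suc v → lower (log b n) (frac w v)
log-lower b n w v lt = inj₂ (^-cancelˡ-< (suc v) (begin-strict
  (b ^ ∣ ↥ frac w v ∣) ^ suc v  ≡⟨ frac-^ b w v ⟩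
  (b ^ w) ^ ↧ₙ frac w v         <⟨ ^-monoˡ-< (↧ₙ frac w v) lt ⟩
  (n ^ suc v) ^ ↧ₙ frac w v     ≡⟨ ^-swap n (suc v) (↧ₙ frac w v) ⟩
  (n ^ ↧ₙ frac w v) ^ suc v     ∎))
  where open ≤-Reasoning

log-upper : ∀ b n w v → n ^ suc v < b ^ w → upper (log b n) (frac w v)
log-upper b n w v lt = frac-nonNeg w v , ^-cancelˡ-< (suc v) (begin-strict
  (n ^ ↧ₙ frac w v) ^ suc v     ≡⟨ ^-swap n (↧ₙ frac w v) (suc v) ⟩
  (n ^ suc v) ^ ↧ₙ frac w v     <⟨ ^-monoˡ-< (↧ₙ frac w v) lt ⟩
  (b ^ w) ^ ↧ₙ frac w v         ≡⟨ frac-^ b w v ⟨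
  (b ^ ∣ ↥ frac w v ∣) ^ suc v  ∎)
  where open ≤-Reasoning

positive-log-lower : ∀ {b n s} → 0ℚ ℚ.< s → lower (log b n) s → b ^ ∣ ↥ s ∣ < n ^ ↧ₙ s
positive-log-lower 0<s (inj₁ s<0) = contradiction s<0 (ℚ.<-asym 0<s)
positive-log-lower 0<s (inj₂ lt)  = lt

log-monoʳ : ∀ b {m n} → m ≤ n → log b m ≤ᴿ log b n
log-monoʳ b m≤n q (inj₁ q<0) = inj₁ q<0
log-monoʳ b m≤n q (inj₂ lt)  = inj₂ (<-≤-trans lt (^-monoˡ-≤ (↧ₙ q) m≤n))

*ᴿ-monoʳ : ∀ x {y z} → y ≤ᴿ z → x *ᴿ y ≤ᴿ x *ᴿ z
*ᴿ-monoʳ x y≤z q (r , s , 0<r , 0<s , lr , ls , q<rs) = r , s , 0<r , 0<s , lr , y≤z s ls , q<rs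

-- Weaker than σ ^ ℓ ≤ m, but it only takes the single rational ℓ/2 below the logarithm.
σ^ℓ<m² : ∀ {c σ m ℓ} → c ≤ᴿ fromℚ 1ℚ → 2 ≤ σ → 1 ≤ ℓ → fromℕ ℓ ≤ᴿ c *ᴿ log σ m → σ ^ ℓ < m ^ 2
σ^ℓ<m² {c} {σ} {m} {ℓ} c≤1 2≤σ 1≤ℓ ℓ≤x =
  from-witness (ℓ≤x (frac ℓ 1) (frac-mono-< {ℓ} {1} {ℓ} {0} (*-monoʳ-< ℓ {{>-nonZero 1≤ℓ}} (s≤s (s≤s z≤n)))))
  where
  from-witness : lower (c *ᴿ log σ m) (frac ℓ 1) → σ ^ ℓ < m ^ 2
  from-witness (r , s , 0<r , 0<s , r<c , s<log , ℓ/2<rs) = ^-cancelˡ-< (↧ₙ s) (begin-strict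
    (σ ^ ℓ) ^ ↧ₙ s        ≡⟨ ^-*-assoc σ ℓ (↧ₙ s) ⟩
    σ ^ (ℓ * ↧ₙ s)        ≤⟨ ^-monoʳ-≤ σ {{>-nonZero (≤-trans (s≤s z≤n) 2≤σ)}} (<⇒≤ ℓ<2s) ⟩
    σ ^ (∣ ↥ s ∣ * 2)     ≡⟨ ^-*-assoc σ ∣ ↥ s ∣ 2 ⟨
    (σ ^ ∣ ↥ s ∣) ^ 2     <⟨ ^-monoˡ-< 2 (positive-log-lower {σ} {m} 0<s s<log) ⟩
    (m ^ ↧ₙ s) ^ 2        ≡⟨ ^-swap m (↧ₙ s) 2 ⟩
    (m ^ 2) ^ ↧ₙ s        ∎)
    where
    open ≤-Reasoning
    ℓ/2<s : frac ℓ 1 ℚ.< s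
    ℓ/2<s = ℚ.<-trans ℓ/2<rs
      (subst (r ℚ.* s ℚ.<_) (ℚ.*-identityˡ s) (ℚ.*-monoˡ-<-pos s {{ℚ.positive 0<s}} (c≤1 r r<c)))
    ℓ<2s : ℓ * ↧ₙ s < ∣ ↥ s ∣ * 2
    ℓ<2s = frac-cancel-< {ℓ} {1} {∣ ↥ s ∣} (subst (frac ℓ 1 ℚ.<_) (nonNeg⇒frac (ℚ.<⇒≤ 0<s)) ℓ/2<s)

-- For m ≥ 2 the reason is m + 1 ≤ m².
log-double : ∀ {σ m s} → 2 ≤ m → upper (log σ m) s → upper (log σ (suc m)) (s ℚ.+ s)
log-double {σ} {m} {s} 2≤m (0≤s , lt) = subst (upper (log σ (suc m))) (sym s+s≡)
  (log-upper σ (suc m) (2 * ∣ ↥ s ∣) (pred (↧ₙ s)) (begin-strict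
    suc m ^ ↧ₙ s            ≤⟨ ^-monoˡ-≤ (↧ₙ s) suc-m≤m² ⟩
    (m ^ 2) ^ ↧ₙ s          ≡⟨ ^-swap m 2 (↧ₙ s) ⟩
    (m ^ ↧ₙ s) ^ 2          <⟨ ^-monoˡ-< 2 lt ⟩
    (σ ^ ∣ ↥ s ∣) ^ 2       ≡⟨ ^-*-assoc σ ∣ ↥ s ∣ 2 ⟩
    σ ^ (∣ ↥ s ∣ * 2)       ≡⟨ cong (σ ^_) (*-comm ∣ ↥ s ∣ 2) ⟩
    σ ^ (2 * ∣ ↥ s ∣)       ∎))
  where
  open ≤-Reasoning
  s+s≡ : s ℚ.+ s ≡ frac (2 * ∣ ↥ s ∣) (pred (↧ₙ s))
  s+s≡ = trans (cong₂ ℚ._+_ (nonNeg⇒frac 0≤s) (nonNeg⇒frac 0≤s)) (frac-double ∣ ↥ s ∣ (pred (↧ₙ s)))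
  suc-m≤m² : suc m ≤ m ^ 2
  suc-m≤m² = begin
    suc m         ≤⟨ +-monoˡ-≤ m (≤-trans (s≤s z≤n) 2≤m) ⟩
    m + m         ≡⟨ cong (m +_) (+-identityʳ m) ⟨
    2 * m         ≤⟨ *-monoˡ-≤ m 2≤m ⟩
    m * m         ≡⟨ cong (m *_) (*-identityʳ m) ⟨
    m ^ 2         ∎

*ᴿ-log-double : ∀ {c σ m t} → 2 ≤ m → c *ᴿ log σ m <ᴿ fromℕ t → c *ᴿ log σ (suc m) <ᴿ fromℕ (2 * t)
*ᴿ-log-double {σ = σ} {m} {t} 2≤m (q , (r , s , c<r , log<s , rs<q) , q<t) =
  q ℚ.+ q ,
  (r , s ℚ.+ s , c<r , log-double {σ} {m} {s} 2≤m log<s , subst (ℚ._< q ℚ.+ q) (sym (ℚ.*-distribˡ-+ r s s)) (ℚ.+-mono-< rs<q rs<q)) ,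
  subst (q ℚ.+ q ℚ.<_) (frac-double t 0) (ℚ.+-mono-< q<t q<t)

-- Rational approximation and the classical floor

floor-log : ∀ {σ} → 2 ≤ σ → ∀ X → 1 ≤ X → ∃[ u ] (σ ^ u ≤ X × X < σ ^ suc u)
floor-log {σ} 2≤σ (suc zero)      _ = 0 , ≤-refl , ≤-trans 2≤σ (≤-reflexive (sym (^-identityʳ σ)))
floor-log {σ} 2≤σ (suc X@(suc _)) _ with floor-log 2≤σ X (s≤s z≤n)
... | u , σ^u≤X , X<σ^1+u with suc X <? σ ^ suc u
...   | yes 1+X<σ^1+u = u , m≤n⇒m≤1+n σ^u≤X , 1+X<σ^1+u
...   | no  1+X≮σ^1+u = suc u , ≮⇒≥ 1+X≮σ^1+u ,
        ≤-<-trans X<σ^1+u (^-monoʳ-< σ 2≤σ (n<1+n (suc u)))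

n<2^n : ∀ n → n < 2 ^ n
n<2^n zero    = ≤-refl
n<2^n (suc n) = ≤-trans (s≤s (n<2^n n)) (+-mono-≤ (m^n>0 2 n) (≤-reflexive (sym (+-identityʳ (2 ^ n)))))

log-approximation : ∀ {σ n} → 2 ≤ σ → 2 ≤ n → ∀ U →
                    ∃[ w ] ∃[ v ] (U ≤ w × lower (log σ n) (frac w v) × upper (log σ n) (frac (2 + w) v))
log-approximation {σ} {n} 2≤σ 2≤n U =
  approximate (floor-log 2≤σ (n ^ suc v) (m^n>0 n {{>-nonZero (≤-trans (s≤s z≤n) 2≤n)}} (suc v)))
  where
  open ≤-Reasoning
  -- Large enough for n ^ (1 + v) ≥ 2 ^ (σ (U + 1)) ≥ σ ^ (U + 1), which forces w ≥ U.
  v = σ * suc U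

  σ^1+U≤n^v : σ ^ suc U ≤ n ^ suc v
  σ^1+U≤n^v = begin
    σ ^ suc U         ≤⟨ ^-monoˡ-≤ (suc U) (<⇒≤ (n<2^n σ)) ⟩
    (2 ^ σ) ^ suc U   ≡⟨ ^-*-assoc 2 σ (suc U) ⟩
    2 ^ v             ≤⟨ ^-monoʳ-≤ 2 (n≤1+n v) ⟩
    2 ^ suc v         ≤⟨ ^-monoˡ-≤ (suc v) 2≤n ⟩
    n ^ suc v         ∎

  U<u : ∀ {u} → n ^ suc v < σ ^ suc u → U < u
  U<u {u} n^v<σ^1+u = ≰⇒> λ u≤U → <⇒≱ n^v<σ^1+u
    (≤-trans (^-monoʳ-≤ σ {{>-nonZero (≤-trans (s≤s z≤n) 2≤σ)}} (s≤s u≤U)) σ^1+U≤n^v)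

  approximate : ∃[ u ] (σ ^ u ≤ n ^ suc v × n ^ suc v < σ ^ suc u) →
                ∃[ w ] ∃[ v ] (U ≤ w × lower (log σ n) (frac w v) × upper (log σ n) (frac (2 + w) v))
  approximate (zero  , _ , n^v<σ)         = contradiction (U<u {zero} n^v<σ) λ ()
  -- The lower bound takes the exponent one below the floor u = w + 1, since σ ^ u may equal n ^ (1
  -- + v) and the cut is strict.
  approximate (suc w , σ^u≤n^v , n^v<σ^1+u) =
    w , v , s≤s⁻¹ (U<u {suc w} n^v<σ^1+u) ,
    log-lower σ n w v (<-≤-trans (^-monoʳ-< σ 2≤σ (n<1+n w)) σ^u≤n^v) ,
    log-upper σ n (2 + w) v n^v<σ^1+u

-- The factor 1 + v in the bound on c cancels the denominator of the bound on the logarithm.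
frac-<-product : ∀ {a b x d} w v → a * suc d < x * w * suc b → frac a b ℚ.< frac (x * suc v) d ℚ.* frac w v
frac-<-product {a} {b} {x} {d} w v lt = subst (frac a b ℚ.<_) (sym (frac-* (x * suc v) d w v))
  (frac-mono-< {a} {b} {x * suc v * w} {v + d * suc v} (begin-strict
    a * (suc d * suc v)     ≡⟨ *-assoc a (suc d) (suc v) ⟨
    a * suc d * suc v       <⟨ *-monoˡ-< (suc v) lt ⟩
    x * w * suc b * suc v   ≡⟨ regroup x w (suc b) (suc v) ⟩
    x * suc v * w * suc b   ∎))
  where
  open ≤-Reasoning
  regroup : ∀ x w b v → x * w * b * v ≡ x * v * w * b
  regroup = solve-∀

frac-product-< : ∀ {t x d} w v → x * w < t * suc d → frac (x * suc v) d ℚ.* frac w v ℚ.< frac t 0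
frac-product-< {t} {x} {d} w v lt = subst (ℚ._< frac t 0) (sym (frac-* (x * suc v) d w v))
  (frac-mono-< {x * suc v * w} {v + d * suc v} {t} {0} (begin-strict
    x * suc v * w * 1       ≡⟨ regroup x (suc v) w ⟩
    x * w * suc v           <⟨ *-monoˡ-< (suc v) lt ⟩
    t * suc d * suc v       ≡⟨ *-assoc t (suc d) (suc v) ⟩
    t * (suc d * suc v)     ∎))
  where
  open ≤-Reasoning
  regroup : ∀ x v w → x * v * w * 1 ≡ x * w * v
  regroup = solve-∀

-- Integrality gives a + 1 ≤ t b, which leaves a gap of y (w + 2). The rounding errors 2 b x and 2 b
-- (w + 2) together stay below 4 b (w + 2), whence y = 4 b.
approximation-slack : ∀ {a b t x y w} → 1 ≤ b → a < t * b → 2 + x ≡ t * y → y ≡ 4 * b → x < 2 + w →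
                      a * (y * (2 + w)) < x * w * b
approximation-slack {a} {b} {t} {x} {y} {w} 1≤b a<tb 2+x≡ty y≡4b x<2+w = +-cancelʳ-< (y * (2 + w)) _ _ (begin-strict
  a * (y * (2 + w)) + y * (2 + w)     ≡⟨ +-comm _ (y * (2 + w)) ⟩
  suc a * (y * (2 + w))               ≤⟨ *-monoˡ-≤ (y * (2 + w)) a<tb ⟩
  t * b * (y * (2 + w))               ≡⟨ regroup t b y (2 + w) ⟩
  t * y * (b * (2 + w))               ≡⟨ cong (_* (b * (2 + w))) 2+x≡ty ⟨
  (2 + x) * (b * (2 + w))             ≡⟨ expand x b w ⟩
  x * w * b + (2 * b * x + 2 * b * (2 + w))
    <⟨ +-monoʳ-< (x * w * b) (+-monoˡ-< (2 * b * (2 + w)) (*-monoʳ-< (2 * b) {{m*n≢0 2 b {{_}} {{>-nonZero 1≤b}}}} x<2+w)) ⟩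
  x * w * b + (2 * b * (2 + w) + 2 * b * (2 + w))
    ≡⟨ cong (x * w * b +_) (double b (2 + w)) ⟩
  x * w * b + 4 * b * (2 + w)         ≡⟨ cong (λ y → x * w * b + y * (2 + w)) y≡4b ⟨
  x * w * b + y * (2 + w)             ∎)
  where
  open ≤-Reasoning
  regroup : ∀ t b y z → t * b * (y * z) ≡ t * y * (b * z)
  regroup = solve-∀
  expand : ∀ x b w → (2 + x) * (b * (2 + w)) ≡ x * w * b + (2 * b * x + 2 * b * (2 + w))
  expand = solve-∀
  double : ∀ b z → 2 * b * z + 2 * b * z ≡ 4 * b * z
  double = solve-∀

-- With Y = 1 + y = 4 (1 + b), V = 1 + v and t Y = 2 + x, locate c between x/Y · V/(w+2) and (1+x)/Y · V/(w+2):
-- multiplied by the bounds w/V and (w+2)/V of the logarithm, these give products above a/(1+b) and below t.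
nonNeg-lower : ∀ {c σ n t} → IsReal c → 2 ≤ σ → 2 ≤ n → ¬ (c *ᴿ log σ n <ᴿ fromℕ t) →
               ∀ a b y → suc y ≡ 4 * suc b → a < t * suc b → lower (c *ᴿ log σ n) (frac a b)
nonNeg-lower {c} {σ} {n} {t} c-real 2≤σ 2≤n x≮t a b y y≡4b a<tb =
  -- The precision t (1 + y) makes w exceed x, as the slack estimate requires.
  locate (t * suc y ∸ 2) (m+[n∸m]≡n (≤-trans (s≤s (s≤s z≤n)) 4≤ty)) (log-approximation 2≤σ 2≤n (t * suc y))
  where
  open IsReal c-real
  instance t≢0 = m*n≢0⇒m≢0 t {{>-nonZero (≤-trans (s≤s z≤n) a<tb)}}

  4≤ty : 4 ≤ t * suc y
  4≤ty = ≤-trans (*-monoʳ-≤ 4 {1} {suc b} (s≤s z≤n)) (≤-trans (≤-reflexive (sym y≡4b)) (m≤n*m (suc y) t))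

  locate : ∀ x → 2 + x ≡ t * suc y →
           ∃[ w ] ∃[ v ] (t * suc y ≤ w × lower (log σ n) (frac w v) × upper (log σ n) (frac (2 + w) v)) →
           lower (c *ᴿ log σ n) (frac a b)
  locate x 2+x≡ty (w , v , ty≤w , w/v<log , log<w+2/v) =
    decide (located (frac-mono-< {x * suc v} {δ} {suc x * suc v} {δ}
      (*-monoˡ-< (suc δ) (*-monoˡ-< (suc v) (n<1+n x)))))
    where
    -- Chosen so that `suc δ` computes to Y (w + 2).
    δ = suc w + y * (2 + w)
    r  = frac (x * suc v) δ
    r′ = frac (suc x * suc v) δ

    1≤x : 1 ≤ x
    1≤x = +-cancelˡ-≤ 2 1 x (≤-trans (n≤1+n 3) (≤-trans 4≤ty (≤-reflexive (sym 2+x≡ty))))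

    1≤w : 1 ≤ w
    1≤w = ≤-trans (≤-trans (s≤s z≤n) 4≤ty) ty≤w

    x<2+w : x < 2 + w
    x<2+w = ≤-trans (n≤1+n (suc x)) (≤-trans (≤-reflexive 2+x≡ty) (≤-trans ty≤w (m≤n+m w 2)))

    1+x<ty : suc x * (2 + w) < t * suc δ
    1+x<ty = begin-strict
      suc x * (2 + w)         <⟨ *-monoˡ-< (2 + w) (n<1+n (suc x)) ⟩
      (2 + x) * (2 + w)       ≡⟨ cong (_* (2 + w)) 2+x≡ty ⟩
      t * suc y * (2 + w)     ≡⟨ *-assoc t (suc y) (2 + w) ⟩
      t * (suc y * (2 + w))   ∎
      where open ≤-Reasoning

    decide : lower c r ⊎ upper c r′ → lower (c *ᴿ log σ n) (frac a b)
    decide (inj₁ r<c)  =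
      r , frac w v , frac-pos δ (*-mono-≤ {1} {x} {1} {suc v} 1≤x (s≤s z≤n)) , frac-pos v 1≤w , r<c , w/v<log ,
      frac-<-product {a} {b} {x} {δ} w v (approximation-slack {t = t} (s≤s z≤n) a<tb 2+x≡ty y≡4b x<2+w)
    decide (inj₂ c<r′) = contradiction (below-t (ℚ.<-dense (frac-product-< {t} {suc x} {δ} (2 + w) v 1+x<ty))) x≮t
      where
      below-t : ∃[ q ] (r′ ℚ.* frac (2 + w) v ℚ.< q × q ℚ.< frac t 0) → c *ᴿ log σ n <ᴿ fromℕ t
      below-t (q , r′s′<q , q<t) = q , (r′ , frac (2 + w) v , c<r′ , log<w+2/v , r′s′<q) , q<t

-- Locatedness is available for c rather than for the product, so nonnegative q go through
-- `nonNeg-lower`; a negative q lies below 0, which is handled as the fraction 0 < t.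
≮ᴿ⇒≥ᴿ : ∀ {c σ n t} → IsReal c → 2 ≤ σ → 2 ≤ n → 1 ≤ t → ¬ (c *ᴿ log σ n <ᴿ fromℕ t) → fromℕ t ≤ᴿ c *ᴿ log σ n
≮ᴿ⇒≥ᴿ {c} {σ} {n} {t} c-real 2≤σ 2≤n 1≤t x≮t q q<t with 0ℚ ℚ.≤? q
... | yes 0≤q = subst (lower (c *ᴿ log σ n)) (sym (nonNeg⇒frac 0≤q))
  (nonNeg-lower {c} {σ} {n} {t} c-real 2≤σ 2≤n x≮t ∣ ↥ q ∣ (pred (↧ₙ q)) _ refl
    (subst (_< t * ↧ₙ q) (*-identityʳ ∣ ↥ q ∣)
      (frac-cancel-< {∣ ↥ q ∣} {pred (↧ₙ q)} {t} {0} (subst (ℚ._< frac t 0) (nonNeg⇒frac 0≤q) q<t))))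
... | no  0≰q = *ᴿ-lower-closed {c} {log σ n} (ℚ.<-≤-trans (ℚ.≰⇒> 0≰q) (frac-nonNeg 0 0))
  (nonNeg-lower {c} {σ} {n} {t} c-real 2≤σ 2≤n x≮t 0 0 3 refl (*-mono-≤ {1} {t} {1} 1≤t ≤-refl))
  where
  *ᴿ-lower-closed : ∀ {x y p q} → p ℚ.< q → lower (x *ᴿ y) q → lower (x *ᴿ y) p
  *ᴿ-lower-closed p<q (r , s , 0<r , 0<s , r<x , s<y , q<rs) = r , s , 0<r , 0<s , r<x , s<y , ℚ.<-trans p<q q<rs

-- An upward search from k with at most j further steps; each comparison with the next integer is
-- decided only under a double negation.
floor-exists : ∀ {c σ n} → IsReal c → 2 ≤ σ → 2 ≤ n → ∀ k j →
               fromℕ k ≤ᴿ c *ᴿ log σ n → c *ᴿ log σ n <ᴿ fromℕ (suc j + k) →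
               ¬ ¬ (∃[ ℓ ] (IsFloor (c *ᴿ log σ n) ℓ × k ≤ ℓ × ℓ ≤ j + k))
floor-exists c-real 2≤σ 2≤n k zero    k≤x x<1+k ∄ = ∄ (k , (k≤x , x<1+k) , ≤-refl , ≤-refl)
floor-exists {c} {σ} {n} c-real 2≤σ 2≤n k (suc j) k≤x x<2+j+k ∄ = ¬¬-excluded-middle λ
  { (yes x<1+k) → ∄ (k , (k≤x , x<1+k) , ≤-refl , m≤n+m k (suc j))
  ; (no  x≮1+k) → floor-exists {c} {σ} {n} c-real 2≤σ 2≤n (suc k) j
      (≮ᴿ⇒≥ᴿ {c} {σ} {n} {suc k} c-real 2≤σ 2≤n (s≤s z≤n) x≮1+k)
      (subst (λ i → c *ᴿ log σ n <ᴿ fromℕ (suc i)) (sym (+-suc j k)) x<2+j+k)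
      λ { (ℓ , floor , k<ℓ , ℓ≤) → ∄ (ℓ , floor , <⇒≤ k<ℓ , ≤-trans ℓ≤ (≤-reflexive (+-suc j k))) } }

-- Lengthening an admissible sequence

-- From c log m < ℓ + 1 follows c log (m + 1) < 2 ℓ + 2, so the new floor is searched between ℓ and
-- 2 ℓ + 1, and the assumed room suffices for it.
next-admissible : ∀ {c σ N m ℓ} → IsReal c → 2 ≤ σ → Admissible c σ N m ℓ → suc m * (2 * ℓ + 1) ≤ N →
                  ¬ ¬ (∃[ ℓ′ ] Admissible c σ N (suc m) ℓ′)
next-admissible {c} {σ} {N} {m} {ℓ} c-real 2≤σ (2≤m , (ℓ≤x , x<1+ℓ) , 1≤ℓ , _) room =
  ¬¬-map (λ { (ℓ′ , floor , ℓ≤ℓ′ , ℓ′≤) →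
      ℓ′ , m≤n⇒m≤1+n 2≤m , floor , ≤-trans 1≤ℓ ℓ≤ℓ′ ,
      ≤-trans (*-monoʳ-≤ (suc m) (≤-trans ℓ′≤ (≤-reflexive (shift ℓ)))) room })
    (floor-exists {c} {σ} {suc m} c-real 2≤σ (m≤n⇒m≤1+n 2≤m) ℓ (suc ℓ)
      (λ q q<ℓ → *ᴿ-monoʳ c {log σ m} {log σ (suc m)} (log-monoʳ σ (n≤1+n m)) q (ℓ≤x q q<ℓ))
      (subst (λ t → c *ᴿ log σ (suc m) <ᴿ fromℕ t) (twice ℓ)
        (*ᴿ-log-double {c} {σ} {m} {suc ℓ} 2≤m x<1+ℓ)))
  where
  shift : ∀ ℓ → suc ℓ + ℓ ≡ 2 * ℓ + 1
  shift = solve-∀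
  twice : ∀ ℓ → 2 * suc ℓ ≡ suc (suc ℓ) + ℓ
  twice = solve-∀

-- As long as N > 5 m ℓ, the length m can grow by one. The fuel bounds N - m, and when it runs out N
-- ≤ m ≤ 5 m ℓ.
σ^N≤ : ∀ {c σ N S} → IsReal c → c ≤ᴿ fromℚ 1ℚ → 2 ≤ σ →
       (D : DataStructure c σ N) → (∀ I → DataStructure.space D I ≤ S) →
       ∀ fuel {m ℓ} → Admissible c σ N m ℓ → N ≤ m + fuel → ¬ ¬ (σ ^ N ≤ 2 ^ (240 * S))
σ^N≤ {c} {σ} {N} {S} c-real c≤1 2≤σ D space≤S fuel {m} {ℓ} adm@(2≤m , (ℓ≤x , _) , 1≤ℓ , _) N≤m+fuel
  with N ≤? 5 * (m * ℓ)
... | yes N≤5mℓ = λ ¬bound →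
  ¬bound (space-lower-bound D space≤S adm 2≤σ (σ^ℓ<m² {c} {σ} {m} {ℓ} c≤1 2≤σ 1≤ℓ ℓ≤x) N≤5mℓ)
... | no  N≰5mℓ = continue fuel N≤m+fuel
  where
  open ≤-Reasoning
  m≤mℓ : m ≤ m * ℓ
  m≤mℓ = m≤m*n m ℓ {{>-nonZero 1≤ℓ}}

  -- The factor 5 arises here: the product is 2 m ℓ + m + 2 ℓ + 1, and each of m, 2 ℓ and 1 is at
  -- most m ℓ.
  room : suc m * (2 * ℓ + 1) ≤ N
  room = begin
    suc m * (2 * ℓ + 1)                    ≡⟨ expand m ℓ ⟩
    2 * (m * ℓ) + m + 2 * ℓ + 1            ≤⟨ +-mono-≤ (+-mono-≤ (+-monoʳ-≤ (2 * (m * ℓ)) m≤mℓ) (*-monoˡ-≤ ℓ 2≤m))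
                                               (≤-trans (≤-trans (s≤s z≤n) 2≤m) m≤mℓ) ⟩
    2 * (m * ℓ) + m * ℓ + m * ℓ + m * ℓ    ≡⟨ collect (m * ℓ) ⟩
    5 * (m * ℓ)                            ≤⟨ ≰⇒≥ N≰5mℓ ⟩
    N                                      ∎
    where
    expand : ∀ m ℓ → suc m * (2 * ℓ + 1) ≡ 2 * (m * ℓ) + m + 2 * ℓ + 1
    expand = solve-∀
    collect : ∀ x → 2 * x + x + x + x ≡ 5 * x
    collect = solve-∀

  continue : ∀ fuel → N ≤ m + fuel → ¬ ¬ (σ ^ N ≤ 2 ^ (240 * S))
  continue zero       N≤m = contradiction
    (≤-trans N≤m (≤-trans (≤-reflexive (+-identityʳ m)) (≤-trans m≤mℓ (m≤n*m (m * ℓ) 5)))) N≰5mℓ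
  continue (suc fuel) N≤m+1+fuel ¬bound = next-admissible {c} {σ} {N} {m} {ℓ} c-real 2≤σ adm room λ { (ℓ′ , adm′) →
    σ^N≤ c-real c≤1 2≤σ D space≤S fuel adm′ (≤-trans N≤m+1+fuel (≤-reflexive (+-suc m fuel))) ¬bound }

-- From powers to logarithms

exponent-bound : ∀ {σ N M u d} → σ ^ N ≤ 2 ^ M → 2 ^ u < σ ^ d → u * N ≤ M * d
exponent-bound {σ} {N} {M} {u} {d} σ^N≤2^M 2^u<σ^d =
  ≮⇒≥ λ Md<uN → <⇒≱ (^-monoʳ-< 2 (s≤s (s≤s z≤n)) Md<uN) (begin
    2 ^ (u * N)   ≡⟨ ^-*-assoc 2 u N ⟨
    (2 ^ u) ^ N   ≤⟨ ^-monoˡ-≤ N (<⇒≤ 2^u<σ^d) ⟩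
    (σ ^ d) ^ N   ≡⟨ ^-swap σ d N ⟩
    (σ ^ N) ^ d   ≤⟨ ^-monoˡ-≤ d σ^N≤2^M ⟩
    (2 ^ M) ^ d   ≡⟨ ^-*-assoc 2 M d ⟩
    2 ^ (M * d)   ∎)
  where open ≤-Reasoning

-- A rational below the product is below N u / ((1 + k) d) for some u / d below the logarithm of σ,
-- so a comparison of powers of 2 suffices.
log-product-bound : ∀ {σ N k S} → σ ^ N ≤ 2 ^ (suc k * S) →
                    fromℚ (frac 1 k) *ᴿ (fromℕ N *ᴿ log 2 σ) ≤ᴿ fromℕ S
log-product-bound {σ} {N} {k} {S} σ^N≤2^kS q
  (r₁ , s₁ , 0<r₁ , 0<s₁ , r₁<K , (r₂ , s₂ , 0<r₂ , 0<s₂ , r₂<N , s₂<log , s₁<r₂s₂) , q<r₁s₁) = begin-strict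
  q                                         <⟨ q<r₁s₁ ⟩
  r₁ ℚ.* s₁                                 <⟨ ℚ.*-monoˡ-<-pos s₁ {{ℚ.positive 0<s₁}} r₁<K ⟩
  frac 1 k ℚ.* s₁                           <⟨ ℚ.*-monoʳ-<-pos (frac 1 k) {{K-pos}} s₁<r₂s₂ ⟩
  frac 1 k ℚ.* (r₂ ℚ.* s₂)                  <⟨ ℚ.*-monoʳ-<-pos (frac 1 k) {{K-pos}} (ℚ.*-monoˡ-<-pos s₂ {{ℚ.positive 0<s₂}} r₂<N) ⟩
  frac 1 k ℚ.* (frac N 0 ℚ.* s₂)            ≡⟨ cong (λ s → frac 1 k ℚ.* (frac N 0 ℚ.* s)) (nonNeg⇒frac (ℚ.<⇒≤ 0<s₂)) ⟩
  frac 1 k ℚ.* (frac N 0 ℚ.* frac u v)      ≡⟨ cong (frac 1 k ℚ.*_) (frac-* N 0 u v) ⟩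
  frac 1 k ℚ.* frac (N * u) (v + 0)         ≡⟨ frac-* 1 k (N * u) (v + 0) ⟩
  frac (1 * (N * u)) (v + 0 + k * suc (v + 0)) ≤⟨ frac-mono-≤ {1 * (N * u)} {v + 0 + k * suc (v + 0)} {S} {0} cross ⟩
  frac S 0                                  ∎
  where
  open ℚ.≤-Reasoning
  u = ∣ ↥ s₂ ∣
  v = pred (↧ₙ s₂)

  K-pos : ℚ.Positive (frac 1 k)
  K-pos = ℚ.positive (frac-pos {1} k (s≤s z≤n))

  uN≤kSd : u * N ≤ suc k * S * suc v
  uN≤kSd = exponent-bound {σ} {N} {suc k * S} {u} {suc v} σ^N≤2^kS (positive-log-lower {2} {σ} 0<s₂ s₂<log)

  cross : 1 * (N * u) * 1 ≤ S * suc (v + 0 + k * suc (v + 0))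
  cross = subst₂ _≤_ (lhs u N) (rhs k S v) uN≤kSd
    where
    lhs : ∀ u N → u * N ≡ 1 * (N * u) * 1
    lhs = solve-∀
    rhs : ∀ k S v → suc k * S * suc v ≡ S * suc (v + 0 + k * suc (v + 0))
    rhs = solve-∀

corollary5p25 : (c : Cut) → IsReal c → fromℚ 0ℚ <ᴿ c → c ≤ᴿ fromℚ 1ℚ →
    ∃[ K ] (0ℚ ℚ.< K ×
    ((σ N : ℕ) → 2 ≤ σ → 2 ≤ N →
    ∃[ m ] ∃[ ℓ ] Admissible c σ N m ℓ →
    (D : DataStructure c σ N) (S : ℕ) → IsWorstCaseSpace D S →
    fromℚ K *ᴿ (fromℕ N *ᴿ log 2 σ) ≤ᴿ fromℕ S))
-- The constant is 1/240, since `frac` adds one to the denominator. The inequality between powers is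
-- decidable, which removes the double negation; the fuel N is enough for every m.
corollary5p25 c c-real _ c≤1 = frac 1 239 , frac-pos {1} 239 (s≤s z≤n) , λ σ N 2≤σ _ (m , ℓ , adm) D S (space≤S , _) →
  log-product-bound {σ} {N} {239} {S} (decidable-stable (σ ^ N ≤? 2 ^ (240 * S))
    (σ^N≤ c-real c≤1 2≤σ D space≤S N adm (m≤n+m N m)))
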